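{- Let $q$ be a complex number with $|q|<1$, and for integers $m\ge0$ let $$U_m(x)=\sum_{k=0}^m\begin{bmatrix}m+k\\k\end{bmatrix}_q\frac{x^k}{(-q;q)_k}.$$ Then for every integer $m\ge 0$ and every $x$, $$U_{m}(xq^2)=(1-x)U_m(x)+xq^{m+1}U_m(xq)+x^{m+1}\frac{(q;q^2)_{m+1}}{(q;q)_m}.$$
   Context: For integers $n\ge 0$, $(x;p)_n=\prod_{i=0}^{n-1}(1-xp^i)$ (empty product equal to $1$). The $q$-binomial coefficient is $\begin{bmatrix}n\\k\end{bmatrix}_q=\frac{(q;q)_n}{(q;q)_{n-k}(q;q)_k}$. -}

module Defs where

open import Algebra.Bundles.Raw using (RawRing)
import Algebra.Definitions.RawSemiring as RawSemiringDefinitions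
open import Data.Fin.Base using (Fin; toℕ)
import Data.Fin.Base as Fin
open import Data.Integer.Base as ℤ using (-[1+_])
import Data.Integer.Properties as ℤ
open import Data.Nat.Base as ℕ using (ℕ; zero; suc)
import Data.Nat.Coprimality as Coprime
import Data.Nat.Properties as ℕ
open import Data.Product.Base using (∃; _×_; _,_; proj₁; proj₂)
import Data.Rational.Base
open import Data.Rational.Base as ℚ using (ℚ; mkℚ; 0ℚ; 1ℚ; ½)
import Data.Rational.Properties as ℚ
open import Data.Rational.Solver using (module +-*-Solver)
import Data.Rational.Unnormalised.Base as ℚᵘ
import Data.Rational.Unnormalised.Properties as ℚᵘ
open import Data.Sum.Base using (inj₁; inj₂)
open import Level using (0ℓ)
open import Relation.Binary.PropositionalEquality
  using (_≡_; refl; sym; trans; cong; cong₂; subst; subst₂)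
open import Relation.Nullary.Decidable using (yes; no)
open import Relation.Nullary.Negation using (contradiction)

module Rational where
  open Data.Rational.Base
    using (_≤_; _<_; _+_; _*_; _-_; -_; ∣_∣)

  ≤-by : ∀ {a b} d → 0ℚ ≤ d → a + d ≡ b → a ≤ b
  ≤-by {a} {b} d 0≤d eq =
    subst₂ _≤_ (ℚ.+-identityʳ a) eq (ℚ.+-monoʳ-≤ a 0≤d)

  <-by : ∀ {a b} d → 0ℚ < d → a + d ≡ b → a < b
  <-by {a} {b} d 0<d eq =
    subst₂ _<_ (ℚ.+-identityʳ a) eq (ℚ.+-monoʳ-< a 0<d)

  0≤b-a : ∀ {a b} → a ≤ b → 0ℚ ≤ b - a
  0≤b-a {a} {b} a≤b =
    subst (_≤ b - a) (ℚ.+-inverseʳ a) (ℚ.+-monoˡ-≤ (- a) a≤b)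

  0<b-a : ∀ {a b} → a < b → 0ℚ < b - a
  0<b-a {a} {b} a<b =
    subst (_< b - a) (ℚ.+-inverseʳ a) (ℚ.+-monoˡ-< (- a) a<b)

  0≤+ : ∀ {a b} → 0ℚ ≤ a → 0ℚ ≤ b → 0ℚ ≤ a + b
  0≤+ = ℚ.+-mono-≤

  0<+ : ∀ {a b} → 0ℚ < a → 0ℚ ≤ b → 0ℚ < a + b
  0<+ = ℚ.+-mono-<-≤

  0≤* : ∀ {a b} → 0ℚ ≤ a → 0ℚ ≤ b → 0ℚ ≤ a * b
  0≤* {a} {b} 0≤a 0≤b = ℚ.nonNegative⁻¹ (a * b)
    {{ℚ.nonNeg*nonNeg⇒nonNeg a {{ℚ.nonNegative 0≤a}} b {{ℚ.nonNegative 0≤b}}}}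

  0<* : ∀ {a b} → 0ℚ < a → 0ℚ < b → 0ℚ < a * b
  0<* {a} {b} 0<a 0<b = ℚ.positive⁻¹ (a * b)
    {{ℚ.pos*pos⇒pos a {{ℚ.positive 0<a}} b {{ℚ.positive 0<b}}}}

  0<½ : 0ℚ < ½
  0<½ = ℚ.positive⁻¹ ½

  0<1 : 0ℚ < 1ℚ
  0<1 = ℚ.positive⁻¹ 1ℚ

  open +-*-Solver

  0≤a² : ∀ a → 0ℚ ≤ a * a
  0≤a² a with ℚ.≤-total 0ℚ a
  ... | inj₁ 0≤a = 0≤* 0≤a 0≤a
  ... | inj₂ a≤0 = subst (0ℚ ≤_)
    (solve 1 (λ a → (con 0ℚ :- a) :* (con 0ℚ :- a) := a :* a) refl a)
    (0≤* (0≤b-a a≤0) (0≤b-a a≤0))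

  *-mono : ∀ {a b c d} → 0ℚ ≤ a → 0ℚ ≤ d → a ≤ b → c ≤ d → a * c ≤ b * d
  *-mono {a} {b} {c} {d} 0≤a 0≤d a≤b c≤d =
    ≤-by (a * (d - c) + (b - a) * d)
      (0≤+ (0≤* 0≤a (0≤b-a c≤d)) (0≤* (0≤b-a a≤b) 0≤d))
      (solve 4 (λ a b c d →
        a :* c :+ (a :* (d :- c) :+ (b :- a) :* d) := b :* d) refl a b c d)

  a≤∣a∣ : ∀ a → a ≤ ∣ a ∣
  a≤∣a∣ a with ℚ.≤-total 0ℚ a
  ... | inj₁ 0≤a = ℚ.≤-reflexive (sym (ℚ.0≤p⇒∣p∣≡p 0≤a))
  ... | inj₂ a≤0 = ℚ.≤-trans a≤0 (ℚ.0≤∣p∣ a)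

  ∣a∣<b : ∀ {a b} → a < b → - a < b → ∣ a ∣ < b
  ∣a∣<b {a} {b} a<b -a<b with ℚ.∣p∣≡p∨∣p∣≡-p a
  ... | inj₁ eq = subst (_< b) (sym eq) a<b
  ... | inj₂ eq = subst (_< b) (sym eq) -a<b

  ∣a-b∣≡∣b-a∣ : ∀ a b → ∣ a - b ∣ ≡ ∣ b - a ∣
  ∣a-b∣≡∣b-a∣ a b = trans (sym (ℚ.∣-p∣≡∣p∣ (a - b)))
    (cong ∣_∣ (solve 2 (λ a b → :- (a :- b) := b :- a) refl a b))

  ∣∣-cancel : ∀ a b {c} → ∣ a - b ∣ < c → a - b < c
  ∣∣-cancel a b = ℚ.≤-<-trans (a≤∣a∣ (a - b))

  -- The reciprocal, extended by 0⁻¹ = 0.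
  infix 8 _⁻¹
  _⁻¹ : ℚ → ℚ
  a ⁻¹ with a ℚ.≟ 0ℚ
  ... | yes _  = 0ℚ
  ... | no a≢0 = (ℚ.1/ a) {{ℚ.≢-nonZero a≢0}}

  *-⁻¹ : ∀ {a} → 0ℚ < a → a * a ⁻¹ ≡ 1ℚ
  *-⁻¹ {a} 0<a with a ℚ.≟ 0ℚ
  ... | yes a≡0 = contradiction (sym a≡0) (ℚ.<⇒≢ 0<a)
  ... | no a≢0  = ℚ.*-inverseʳ a {{ℚ.≢-nonZero a≢0}}

  0<⁻¹ : ∀ {a} → 0ℚ < a → 0ℚ < a ⁻¹
  0<⁻¹ {a} 0<a with 0ℚ ℚ.<? a ⁻¹
  ... | yes p = p
  ... | no ¬p = contradiction 0<1 (λ 0<1 → ℚ.<-irrefl refl (ℚ.<-≤-trans 0<1 (≤-by (a * (0ℚ - a ⁻¹))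
    (0≤* (ℚ.<⇒≤ 0<a) (0≤b-a (ℚ.≮⇒≥ ¬p)))
    (trans (cong (λ e → e + a * (0ℚ - a ⁻¹)) (sym (*-⁻¹ 0<a)))
      (solve 2 (λ a b → a :* b :+ a :* (con 0ℚ :- b) := con 0ℚ) refl a (a ⁻¹))))))

  ½^_ : ℕ → ℚ
  ½^ zero  = 1ℚ
  ½^ suc n = ½ * ½^ n

  0<½^ : ∀ n → 0ℚ < ½^ n
  0<½^ zero    = 0<1
  0<½^ (suc n) = 0<* 0<½ (0<½^ n)

  fromℕ : ℕ → ℚ
  fromℕ n = mkℚ (ℤ.+ n) 0 (Coprime.sym (Coprime.1-coprimeTo n))

  fromℕ-suc : ∀ n → fromℕ (suc n) ≡ 1ℚ + fromℕ n
  fromℕ-suc n = ℚ.toℚᵘ-injective (ℚᵘ.≃-trans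
    (ℚᵘ.*≡* (cong (λ k → (ℤ.+ 1 ℤ.+ k) ℤ.* ℤ.+ 1) (sym (ℤ.*-identityʳ (ℤ.+ n)))))
    (ℚᵘ.≃-sym (ℚ.toℚᵘ-homo-+ 1ℚ (fromℕ n))))

  0≤fromℕ : ∀ n → 0ℚ ≤ fromℕ n
  0≤fromℕ n = ℚ.nonNegative⁻¹ (fromℕ n)

  archimedean : ∀ a → ∃ λ n → a ≤ fromℕ n
  archimedean (mkℚ (ℤ.+ n) d c) = n , ℚ.*≤*
    (ℤ.*-monoˡ-≤-nonNeg (ℤ.+ n) (ℤ.+≤+ (ℕ.s≤s ℕ.z≤n)))
  archimedean a@(mkℚ -[1+ n ] d c) =
    0 , ℚ.≤-trans (ℚ.<⇒≤ (ℚ.negative⁻¹ a)) (0≤fromℕ 0)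

  n½^n≤1 : ∀ n → fromℕ (suc n) * ½^ n ≤ 1ℚ
  n½^n≤1 zero    = ℚ.≤-reflexive (ℚ.*-identityʳ (fromℕ 1))
  n½^n≤1 (suc n) = ℚ.≤-trans
    (≤-by (fromℕ n * (½ * h)) (0≤* (0≤fromℕ n) (0≤* (ℚ.<⇒≤ 0<½) (ℚ.<⇒≤ (0<½^ n))))
      (trans
        (cong (λ k → k * (½ * h) + fromℕ n * (½ * h))
          (trans (fromℕ-suc (suc n)) (cong (1ℚ +_) (fromℕ-suc n))))
        (trans
          (solve 2 (λ k h →
            (con 1ℚ :+ (con 1ℚ :+ k)) :* (con ½ :* h) :+ k :* (con ½ :* h)
              := (con 1ℚ :+ k) :* h) refl (fromℕ n) h)
          (cong (_* h) (sym (fromℕ-suc n))))))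
    (n½^n≤1 n)
    where h = ½^ n

  ½^-antitone : ∀ {m n} → m ℕ.≤′ n → ½^ n ≤ ½^ m
  ½^-antitone ℕ.≤′-refl = ℚ.≤-refl
  ½^-antitone (ℕ.≤′-step {n} m≤n) = ℚ.≤-trans
    (≤-by (½ * ½^ n) (0≤* (ℚ.<⇒≤ 0<½) (ℚ.<⇒≤ (0<½^ n)))
      (solve 1 (λ h → con ½ :* h :+ con ½ :* h := h) refl (½^ n)))
    (½^-antitone m≤n)

  fromℕ-≤-suc : ∀ n → fromℕ n ≤ fromℕ (suc n)
  fromℕ-≤-suc n = ≤-by 1ℚ (ℚ.<⇒≤ 0<1)
    (trans (ℚ.+-comm (fromℕ n) 1ℚ) (sym (fromℕ-suc n)))

  ½^-small : ∀ {ε b} → 0ℚ < ε → 0ℚ ≤ b → ∃ λ N → ∀ n → N ℕ.≤ n → b * ½^ n ≤ ε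
  ½^-small {ε} {b} 0<ε 0≤b = N , λ n N≤n → ℚ.≤-trans
    (*-mono 0≤b (ℚ.<⇒≤ (0<½^ N)) b≤N*ε (½^-antitone (ℕ.≤⇒≤′ N≤n)))
    (subst₂ _≤_
      (solve 3 (λ k e h → e :* (k :* h) := k :* e :* h) refl (fromℕ N) ε (½^ N))
      (ℚ.*-identityʳ ε)
      (*-mono (ℚ.<⇒≤ 0<ε) (ℚ.<⇒≤ 0<1) ℚ.≤-refl
        (ℚ.≤-trans
          (*-mono (0≤fromℕ N) (ℚ.<⇒≤ (0<½^ N)) (fromℕ-≤-suc N) ℚ.≤-refl)
          (n½^n≤1 N))))
    where
    N = proj₁ (archimedean (b * ε ⁻¹))
    b≤N*ε : b ≤ fromℕ N * ε
    b≤N*ε = subst (_≤ fromℕ N * ε)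
      (trans (solve 3 (λ b e i → b :* i :* e := b :* (e :* i)) refl b ε (ε ⁻¹))
        (trans (cong (b *_) (*-⁻¹ 0<ε)) (ℚ.*-identityʳ b)))
      (*-mono (0≤* 0≤b (ℚ.<⇒≤ (0<⁻¹ 0<ε))) (ℚ.<⇒≤ 0<ε)
        (proj₂ (archimedean (b * ε ⁻¹))) ℚ.≤-refl)

  -- √-approx a n ≤ √a < √-approx a n + √-error a n for a ≥ 0, by bisection
  -- of the interval from 0 to 1 + a.
  √-error : ℚ → ℕ → ℚ
  √-error a n = (1ℚ + a) * ½^ n

  √-approx : ℚ → ℕ → ℚ
  √-approx a zero = 0ℚ
  √-approx a (suc n)
    with (√-approx a n + √-error a (suc n)) * (√-approx a n + √-error a (suc n)) ℚ.≤? a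
  ... | yes _ = √-approx a n + √-error a (suc n)
  ... | no  _ = √-approx a n

  module _ {a} (0≤a : 0ℚ ≤ a) where

    0≤√-error : ∀ n → 0ℚ ≤ √-error a n
    0≤√-error n = 0≤* (0≤+ (ℚ.<⇒≤ 0<1) 0≤a) (ℚ.<⇒≤ (0<½^ n))

    0≤√-approx : ∀ n → 0ℚ ≤ √-approx a n
    0≤√-approx zero = ℚ.≤-refl
    0≤√-approx (suc n)
      with (√-approx a n + √-error a (suc n)) * (√-approx a n + √-error a (suc n)) ℚ.≤? a
    ... | yes _ = 0≤+ (0≤√-approx n) (0≤√-error (suc n))
    ... | no  _ = 0≤√-approx n

    √-lower : ∀ n → √-approx a n * √-approx a n ≤ a
    √-lower zero = 0≤a
    √-lower (suc n)
      with (√-approx a n + √-error a (suc n)) * (√-approx a n + √-error a (suc n)) ℚ.≤? a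
    ... | yes c²≤a = c²≤a
    ... | no  _    = √-lower n

    √-upper : ∀ n →
      a < (√-approx a n + √-error a n) * (√-approx a n + √-error a n)
    √-upper zero = <-by (1ℚ + a + a * a)
      (0<+ (0<+ 0<1 0≤a) (0≤* 0≤a 0≤a))
      (solve 1 (λ a → a :+ (con 1ℚ :+ a :+ a :* a) :=
        (con 0ℚ :+ (con 1ℚ :+ a) :* con 1ℚ) :* (con 0ℚ :+ (con 1ℚ :+ a) :* con 1ℚ))
        refl a)
    √-upper (suc n)
      with (√-approx a n + √-error a (suc n)) * (√-approx a n + √-error a (suc n)) ℚ.≤? a
    ... | yes _ = subst (a <_)
      (solve 3 (λ s a h →
        (s :+ (con 1ℚ :+ a) :* h) :* (s :+ (con 1ℚ :+ a) :* h) :=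
        (s :+ (con 1ℚ :+ a) :* (con ½ :* h) :+ (con 1ℚ :+ a) :* (con ½ :* h)) :*
        (s :+ (con 1ℚ :+ a) :* (con ½ :* h) :+ (con 1ℚ :+ a) :* (con ½ :* h)))
        refl (√-approx a n) a (½^ n))
      (√-upper n)
    ... | no c²≰a = ℚ.≰⇒> c²≰a

open Rational

-- ∀∞ P: P n holds for all sufficiently large n.
∀∞ : (ℕ → Set) → Set
∀∞ P = ∃ λ N → ∀ n → N ℕ.≤ n → P n

∀∞₂ : (ℕ → ℕ → Set) → Set
∀∞₂ P = ∃ λ N → ∀ m n → N ℕ.≤ m → N ℕ.≤ n → P m n

∀∞-map : ∀ {P Q} → (∀ n → P n → Q n) → ∀∞ P → ∀∞ Q
∀∞-map f (N , p) = N , λ n N≤n → f n (p n N≤n)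

∀∞-map₂ : ∀ {P Q R} → (∀ n → P n → Q n → R n) → ∀∞ P → ∀∞ Q → ∀∞ R
∀∞-map₂ f (M , p) (N , q) = M ℕ.⊔ N , λ n M⊔N≤n → f n
  (p n (ℕ.m⊔n≤o⇒m≤o M N M⊔N≤n)) (q n (ℕ.m⊔n≤o⇒n≤o M N M⊔N≤n))

∀∞₂-map : ∀ {P Q} → (∀ m n → P m n → Q m n) → ∀∞₂ P → ∀∞₂ Q
∀∞₂-map f (N , p) = N , λ m n N≤m N≤n → f m n (p m n N≤m N≤n)

∀∞₂-map₂ : ∀ {P Q R} → (∀ m n → P m n → Q m n → R m n) →
  ∀∞₂ P → ∀∞₂ Q → ∀∞₂ R
∀∞₂-map₂ f (M , p) (N , q) = M ℕ.⊔ N , λ m n l r → f m n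
  (p m n (ℕ.m⊔n≤o⇒m≤o M N l) (ℕ.m⊔n≤o⇒m≤o M N r))
  (q m n (ℕ.m⊔n≤o⇒n≤o M N l) (ℕ.m⊔n≤o⇒n≤o M N r))

∀∞⇒∀∞₂ : ∀ {P} → ∀∞ P → ∀∞₂ (λ m n → P m × P n)
∀∞⇒∀∞₂ (N , p) = N , λ m n N≤m N≤n → p m N≤m , p n N≤n

Cauchy : (ℕ → ℚ) → Set
Cauchy x = ∀ {ε} → 0ℚ ℚ.< ε → ∀∞₂ λ m n → ℚ.∣ x m ℚ.- x n ∣ ℚ.< ε

-- A real number is a Cauchy sequence of rationals, up to _≈ᵣ_.
record ℝ : Set where
  no-eta-equality
  constructor mkℝ
  field
    seq    : ℕ → ℚ
    cauchy : Cauchy seq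
open ℝ public

infix 4 _≈ᵣ_ _<ᵣ_

_≈ᵣ_ : ℝ → ℝ → Set
x ≈ᵣ y = ∀ {ε} → 0ℚ ℚ.< ε → ∀∞ λ n → ℚ.∣ seq x n ℚ.- seq y n ∣ ℚ.< ε

_<ᵣ_ : ℝ → ℝ → Set
x <ᵣ y = ∃ λ ε → 0ℚ ℚ.< ε × ∀∞ λ n → seq x n ℚ.+ ε ℚ.≤ seq y n

module Operations where
  open Data.Rational.Base using (_≤_; _<_; _+_; _*_; _-_; -_; ∣_∣)
  open +-*-Solver

  const-cauchy : ∀ a → Cauchy (λ _ → a)
  const-cauchy a {ε} 0<ε = 0 , λ _ _ _ _ →
    subst (_< ε) (sym (cong ∣_∣ (ℚ.+-inverseʳ a))) 0<ε

  +-cauchy : ∀ {x y} → Cauchy x → Cauchy y → Cauchy (λ n → x n + y n)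
  +-cauchy {x} {y} cx cy {ε} 0<ε = ∀∞₂-map₂
    (λ m n p q → ℚ.≤-<-trans
      (subst (_≤ ∣ x m - x n ∣ + ∣ y m - y n ∣)
        (cong ∣_∣ (solve 4 (λ a b c d →
          (a :- b) :+ (c :- d) := (a :+ c) :- (b :+ d)) refl (x m) (x n) (y m) (y n)))
        (ℚ.∣p+q∣≤∣p∣+∣q∣ (x m - x n) (y m - y n)))
      (subst (∣ x m - x n ∣ + ∣ y m - y n ∣ <_)
        (solve 1 (λ e → con ½ :* e :+ con ½ :* e := e) refl ε)
        (ℚ.+-mono-< p q)))
    (cx (0<* 0<½ 0<ε)) (cy (0<* 0<½ 0<ε))

  neg-cauchy : ∀ {x} → Cauchy x → Cauchy (λ n → - x n)
  neg-cauchy {x} cx {ε} 0<ε = ∀∞₂-map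
    (λ m n → subst (_< ε) (trans (sym (ℚ.∣-p∣≡∣p∣ (x m - x n)))
      (cong ∣_∣ (solve 2 (λ a b → :- (a :- b) := (:- a) :- (:- b)) refl (x m) (x n)))))
    (cx 0<ε)

  bounded : ∀ {x} → Cauchy x →
    ∃ λ b → 0ℚ < b × ∀∞ λ n → ∣ x n ∣ ≤ b
  bounded {x} cx = let N , p = cx 0<1 in
    1ℚ + ∣ x N ∣ , 0<+ 0<1 (ℚ.0≤∣p∣ (x N)) , N , λ n N≤n → ℚ.≤-trans
    (subst (_≤ ∣ x n - x N ∣ + ∣ x N ∣)
      (cong ∣_∣ (solve 2 (λ a b → (a :- b) :+ b := a) refl (x n) (x N)))
      (ℚ.∣p+q∣≤∣p∣+∣q∣ (x n - x N) (x N)))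
    (ℚ.+-monoˡ-≤ ∣ x N ∣ (ℚ.<⇒≤ (p n N N≤n ℕ.≤-refl)))

  ∣ac-bd∣ : ∀ a b c d → ∣ a * c - b * d ∣ ≤ ∣ a ∣ * ∣ c - d ∣ + ∣ a - b ∣ * ∣ d ∣
  ∣ac-bd∣ a b c d = subst₂ _≤_
    (cong ∣_∣ (solve 4 (λ a b c d →
      a :* (c :- d) :+ (a :- b) :* d := a :* c :- b :* d) refl a b c d))
    (cong₂ _+_ (ℚ.∣p*q∣≡∣p∣*∣q∣ a (c - d)) (ℚ.∣p*q∣≡∣p∣*∣q∣ (a - b) d))
    (ℚ.∣p+q∣≤∣p∣+∣q∣ (a * (c - d)) ((a - b) * d))

  tolerance : ∀ {a b ε} → 0ℚ < a → 0ℚ < b → 0ℚ < ε →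
    ∃ λ δ → 0ℚ < δ × a * δ + δ * b < ε
  tolerance {a} {b} {ε} 0<a 0<b 0<ε = δ , 0<δ , <-by δ 0<δ
    (trans
      (solve 4 (λ a b e i →
        a :* (e :* i) :+ e :* i :* b :+ e :* i := e :* ((con 1ℚ :+ a :+ b) :* i))
        refl a b ε (c ⁻¹))
      (trans (cong (ε *_) (*-⁻¹ 0<c)) (ℚ.*-identityʳ ε)))
    where
    c = 1ℚ + a + b
    0<c : 0ℚ < c
    0<c = 0<+ (0<+ 0<1 (ℚ.<⇒≤ 0<a)) (ℚ.<⇒≤ 0<b)
    δ = ε * c ⁻¹
    0<δ : 0ℚ < δ
    0<δ = 0<* 0<ε (0<⁻¹ 0<c)

  *-cauchy : ∀ {x y} → Cauchy x → Cauchy y → Cauchy (λ n → x n * y n)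
  *-cauchy {x} {y} cx cy 0<ε =
    let a , 0<a , x≤a = bounded {x} cx
        b , 0<b , y≤b = bounded {y} cy
        δ , 0<δ , small = tolerance 0<a 0<b 0<ε
    in ∀∞₂-map₂
      (λ m n (dx , dy) ((xm≤a , _) , (_ , yn≤b)) → ℚ.≤-<-trans
        (∣ac-bd∣ (x m) (x n) (y m) (y n))
        (ℚ.≤-<-trans
          (ℚ.+-mono-≤
            (*-mono (ℚ.0≤∣p∣ (x m)) (ℚ.<⇒≤ 0<δ) xm≤a (ℚ.<⇒≤ dy))
            (*-mono (ℚ.0≤∣p∣ (x m - x n)) (ℚ.<⇒≤ 0<b) (ℚ.<⇒≤ dx) yn≤b))
          small))
      (∀∞₂-map₂ (λ _ _ → _,_) (cx 0<δ) (cy 0<δ))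
      (∀∞₂-map₂ (λ _ _ → _,_) (∀∞⇒∀∞₂ x≤a) (∀∞⇒∀∞₂ y≤b))

  ⁻¹-cauchy : ∀ {x c} → Cauchy x → 0ℚ < c → ∀∞ (λ n → c ≤ x n) →
    Cauchy (λ n → x n ⁻¹)
  ⁻¹-cauchy {x} {c} cx 0<c c≤x {ε} 0<ε = ∀∞₂-map₂
    (λ m n d (c≤xm , c≤xn) → ∣a∣<b
      (close (x m) (x n) c≤xm c≤xn (∣∣-cancel (x n) (x m)
        (subst (_< ε * (c * c)) (∣a-b∣≡∣b-a∣ (x m) (x n)) d)))
      (subst (_< ε)
        (solve 2 (λ a b → a :- b := :- (b :- a)) refl (x n ⁻¹) (x m ⁻¹))
        (close (x n) (x m) c≤xn c≤xm (∣∣-cancel (x m) (x n) d))))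
    (cx (0<* 0<ε (0<* 0<c 0<c))) (∀∞⇒∀∞₂ c≤x)
    where
    close : ∀ a b → c ≤ a → c ≤ b → b - a < ε * (c * c) → a ⁻¹ - b ⁻¹ < ε
    close a b c≤a c≤b d = <-by
      (u * v * (ε * (c * c) - (b - a)) + ε * (a * u * (b * v) - c * u * (c * v)))
      (0<+ (0<* (0<* 0<u 0<v) (0<b-a d))
        (0≤* (ℚ.<⇒≤ 0<ε) (0≤b-a (*-mono
          (0≤* (ℚ.<⇒≤ 0<c) (ℚ.<⇒≤ 0<u)) (0≤* (ℚ.<⇒≤ 0<b) (ℚ.<⇒≤ 0<v))
          (*-mono (ℚ.<⇒≤ 0<c) (ℚ.<⇒≤ 0<u) c≤a ℚ.≤-refl)
          (*-mono (ℚ.<⇒≤ 0<c) (ℚ.<⇒≤ 0<v) c≤b ℚ.≤-refl)))))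
      (trans
        (solve 6 (λ a b u v c e →
          (u :- v) :+ (u :* v :* (e :* (c :* c) :- (b :- a))
            :+ e :* (a :* u :* (b :* v) :- c :* u :* (c :* v)))
          := (u :- v) :+ ((a :* u) :* v :- (b :* v) :* u :+ e :* ((a :* u) :* (b :* v))))
          refl a b u v c ε)
        (trans
          (cong₂ (λ p q → (u - v) + (p * v - q * u + ε * (p * q)))
            (*-⁻¹ 0<a) (*-⁻¹ 0<b))
          (solve 3 (λ u v e →
            (u :- v) :+ (con 1ℚ :* v :- con 1ℚ :* u :+ e :* (con 1ℚ :* con 1ℚ)) := e)
            refl u v ε)))
      where
      u = a ⁻¹
      v = b ⁻¹
      0<a = ℚ.<-≤-trans 0<c c≤a
      0<b = ℚ.<-≤-trans 0<c c≤b
      0<u = 0<⁻¹ 0<a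
      0<v = 0<⁻¹ 0<b

  √-error-small : ∀ {x} → Cauchy x → (∀ n → 0ℚ ≤ x n) →
    ∀ {δ} → 0ℚ < δ → ∀∞ λ n → √-error (x n) n ≤ δ
  √-error-small {x} cx 0≤x 0<δ =
    let b , 0<b , x≤b = bounded {x} cx
    in ∀∞-map₂
      (λ n xn≤b b½^n≤δ → ℚ.≤-trans
        (*-mono (0≤+ (ℚ.<⇒≤ 0<1) (0≤x n)) (ℚ.<⇒≤ (0<½^ n))
          (ℚ.+-monoʳ-≤ 1ℚ (ℚ.≤-trans (a≤∣a∣ (x n)) xn≤b)) ℚ.≤-refl)
        b½^n≤δ)
      x≤b (½^-small 0<δ (0≤+ (ℚ.<⇒≤ 0<1) (ℚ.<⇒≤ 0<b)))

  √-close : ∀ {δ x y s t e} → 0ℚ < δ → 0ℚ ≤ s → 0ℚ ≤ t → 0ℚ ≤ e → e ≤ δ →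
    s * s ≤ x → y < (t + e) * (t + e) → x - y < δ * δ → s - t < δ + δ
  √-close {δ} {x} {y} {s} {t} {e} 0<δ 0≤s 0≤t 0≤e e≤δ s²≤x y<[t+e]² x-y<δ² =
    ℚ.≰⇒> λ 2δ≤s-t → ℚ.<-irrefl refl (ℚ.<-≤-trans x-y<δ² (ℚ.≤-trans
      (≤-by (δ * (t + t) + (δ * δ + δ * δ))
        (0≤+ (0≤* 0≤δ (0≤+ 0≤t 0≤t)) (0≤+ (0≤* 0≤δ 0≤δ) (0≤* 0≤δ 0≤δ)))
        (solve 2 (λ t d →
          d :* d :+ (d :* (t :+ t) :+ (d :* d :+ d :* d)) :=
          (t :+ (d :+ d)) :* (t :+ (d :+ d)) :- (t :+ d) :* (t :+ d)) refl t δ))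
      (ℚ.+-mono-≤ (lower 2δ≤s-t) (ℚ.neg-antimono-≤ upper))))
    where
    0≤δ = ℚ.<⇒≤ 0<δ
    0≤t+2δ : 0ℚ ≤ t + (δ + δ)
    0≤t+2δ = 0≤+ 0≤t (0≤+ 0≤δ 0≤δ)
    t+2δ≤s : δ + δ ≤ s - t → t + (δ + δ) ≤ s
    t+2δ≤s p = ≤-by ((s - t) - (δ + δ)) (0≤b-a p)
      (solve 3 (λ s t d → t :+ (d :+ d) :+ ((s :- t) :- (d :+ d)) := s) refl s t δ)
    lower : δ + δ ≤ s - t → (t + (δ + δ)) * (t + (δ + δ)) ≤ x
    lower p = ℚ.≤-trans (*-mono 0≤t+2δ 0≤s (t+2δ≤s p) (t+2δ≤s p)) s²≤x
    upper : y ≤ (t + δ) * (t + δ)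
    upper = ℚ.≤-trans (ℚ.<⇒≤ y<[t+e]²)
      (*-mono (0≤+ 0≤t 0≤e) (0≤+ 0≤t 0≤δ)
        (ℚ.+-monoʳ-≤ t e≤δ) (ℚ.+-monoʳ-≤ t e≤δ))

  √-cauchy : ∀ {x} → Cauchy x → (∀ n → 0ℚ ≤ x n) →
    Cauchy (λ n → √-approx (x n) n)
  √-cauchy {x} cx 0≤x {ε} 0<ε = ∀∞₂-map₂
    (λ m n d (em , en) → ∣a∣<b
      (close m n en (∣∣-cancel (x m) (x n) d))
      (subst (_< ε)
        (solve 2 (λ a b → a :- b := :- (b :- a)) refl (s n) (s m))
        (close n m em
          (∣∣-cancel (x n) (x m) (subst (_< δ * δ) (∣a-b∣≡∣b-a∣ (x m) (x n)) d)))))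
    (cx (0<* 0<δ 0<δ))
    (∀∞⇒∀∞₂ (√-error-small {x} cx 0≤x 0<δ))
    where
    δ = ½ * ε
    0<δ : 0ℚ < δ
    0<δ = 0<* 0<½ 0<ε
    s : ℕ → ℚ
    s n = √-approx (x n) n
    close : ∀ m n → √-error (x n) n ≤ δ → x m - x n < δ * δ → s m - s n < ε
    close m n en d = subst (s m - s n <_)
      (solve 1 (λ e → con ½ :* e :+ con ½ :* e := e) refl ε)
      (√-close 0<δ (0≤√-approx (0≤x m) m) (0≤√-approx (0≤x n) n)
        (0≤√-error (0≤x n) n) en (√-lower (0≤x m) m) (√-upper (0≤x n) n) d)

open Operations

const : ℚ → ℝ
const a = mkℝ (λ _ → a) (const-cauchy a)

infixl 6 _+ᵣ_
infixl 7 _*ᵣ_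
infix  8 -ᵣ_

_+ᵣ_ _*ᵣ_ : ℝ → ℝ → ℝ
x +ᵣ y = mkℝ (λ n → seq x n ℚ.+ seq y n) (+-cauchy {seq x} {seq y} (cauchy x) (cauchy y))
x *ᵣ y = mkℝ (λ n → seq x n ℚ.* seq y n) (*-cauchy {seq x} {seq y} (cauchy x) (cauchy y))

-ᵣ_ : ℝ → ℝ
-ᵣ x = mkℝ (λ n → ℚ.- seq x n) (neg-cauchy {seq x} (cauchy x))

0ᵣ 1ᵣ : ℝ
0ᵣ = const 0ℚ
1ᵣ = const 1ℚ

reciprocal : (x : ℝ) → 0ᵣ <ᵣ x → ℝ
reciprocal x (c , 0<c , c≤x) = mkℝ (λ n → seq x n ⁻¹)
  (⁻¹-cauchy {seq x} (cauchy x) 0<c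
    (∀∞-map (λ n → subst (ℚ._≤ seq x n) (ℚ.+-identityˡ c)) c≤x))

sqrt : (x : ℝ) → (∀ n → 0ℚ ℚ.≤ seq x n) → ℝ
sqrt x 0≤x = mkℝ (λ n → √-approx (seq x n) n) (√-cauchy {seq x} (cauchy x) 0≤x)

record ℂ : Set where
  no-eta-equality
  constructor mkℂ
  field
    re im : ℝ
open ℂ public

infix  4 _≈_
infixl 6 _+_ _-_
infixl 7 _*_
infix  8 -_

_≈_ : ℂ → ℂ → Set
z ≈ w = re z ≈ᵣ re w × im z ≈ᵣ im w

_+_ _*_ _-_ : ℂ → ℂ → ℂ
z + w = mkℂ (re z +ᵣ re w) (im z +ᵣ im w)
z * w = mkℂ (re z *ᵣ re w +ᵣ -ᵣ (im z *ᵣ im w)) (re z *ᵣ im w +ᵣ im z *ᵣ re w)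
z - w = mkℂ (re z +ᵣ -ᵣ re w) (im z +ᵣ -ᵣ im w)

-_ : ℂ → ℂ
- z = mkℂ (-ᵣ re z) (-ᵣ im z)

0# 1# : ℂ
0# = mkℂ 0ᵣ 0ᵣ
1# = mkℂ 1ᵣ 0ᵣ

ℂ-rawRing : RawRing 0ℓ 0ℓ
ℂ-rawRing = record
  { _≈_ = _≈_
  ; _+_ = _+_
  ; _*_ = _*_
  ; -_  = -_
  ; 0#  = 0#
  ; 1#  = 1#
  }

open RawSemiringDefinitions (RawRing.rawSemiring ℂ-rawRing) public
  using (_^_; sum; product)

∣_∣² : ℂ → ℝ
∣ z ∣² = re z *ᵣ re z +ᵣ im z *ᵣ im z

∣_∣ : ℂ → ℝ
∣ z ∣ = sqrt ∣ z ∣² λ n → 0≤+ (0≤a² (seq (re z) n)) (0≤a² (seq (im z) n))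

-- Constructively, being apart from 0 is stronger than ¬ (z ≈ 0#).
infix 4 _≉0
_≉0 : ℂ → Set
z ≉0 = 0ᵣ <ᵣ ∣ z ∣²

-- w⁻¹ is the conjugate of w divided by ∣w∣².
infixl 7 _/_⟨_⟩
_/_⟨_⟩ : (z w : ℂ) → w ≉0 → ℂ
z / w ⟨ w≉0 ⟩ = z * mkℂ (re w *ᵣ r) (-ᵣ im w *ᵣ r)
  where r = reciprocal ∣ w ∣² w≉0

module ℂ-Lemmas where
  open Data.Rational.Base
    using (_≤_; _<_)
    renaming (_+_ to _+ℚ_; _*_ to _*ℚ_; _-_ to _-ℚ_; -_ to -ℚ_)
  open +-*-Solver

  norm : ℚ → ℚ → ℚ
  norm a b = a *ℚ a +ℚ b *ℚ b

  0≤norm : ∀ a b → 0ℚ ≤ norm a b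
  0≤norm a b = 0≤+ (0≤a² a) (0≤a² b)

  norm-* : ∀ a b c d →
    norm a b *ℚ norm c d ≡ norm (a *ℚ c +ℚ -ℚ (b *ℚ d)) (a *ℚ d +ℚ b *ℚ c)
  norm-* = solve 4 (λ a b c d →
    (a :* a :+ b :* b) :* (c :* c :+ d :* d) :=
    (a :* c :+ :- (b :* d)) :* (a :* c :+ :- (b :* d)) :+
    (a :* d :+ b :* c) :* (a :* d :+ b :* c)) refl

  norm-neg : ∀ a b → norm a b ≡ norm (-ℚ a) (-ℚ b)
  norm-neg = solve 2 (λ a b →
    a :* a :+ b :* b := (:- a) :* (:- a) :+ (:- b) :* (:- b)) refl

  square<1 : ∀ {s e η x} → 0ℚ < η → 0ℚ ≤ s → 0ℚ ≤ e → e ≤ ½ *ℚ η → s +ℚ η ≤ 1ℚ →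
    x < (s +ℚ e) *ℚ (s +ℚ e) → x +ℚ ½ *ℚ η ≤ 1ℚ
  square<1 {s} {e} {η} {x} 0<η 0≤s 0≤e e≤½η s+η≤1 x<[s+e]² =
    ℚ.≤-trans (ℚ.+-monoˡ-≤ (½ *ℚ η) (ℚ.≤-trans (ℚ.<⇒≤ x<[s+e]²)
      (ℚ.≤-trans (*-mono (0≤+ 0≤s 0≤e) (ℚ.<⇒≤ 0<1) s+e≤s+½η s+e≤1)
        (ℚ.≤-reflexive (ℚ.*-identityʳ (s +ℚ ½ *ℚ η))))))
      (subst (_≤ 1ℚ)
        (solve 2 (λ s h → s :+ h := s :+ con ½ :* h :+ con ½ :* h) refl s η)
        s+η≤1)
    where
    s+e≤s+½η = ℚ.+-monoʳ-≤ s e≤½η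
    s+e≤1 : s +ℚ e ≤ 1ℚ
    s+e≤1 = ℚ.≤-trans s+e≤s+½η (ℚ.≤-trans
      (≤-by (½ *ℚ η) (0≤* (ℚ.<⇒≤ 0<½) (ℚ.<⇒≤ 0<η))
        (solve 2 (λ s h → s :+ con ½ :* h :+ con ½ :* h := s :+ h) refl s η))
      s+η≤1)

  norm-1- : ∀ {ε} a b → 0ℚ < ε → norm a b +ℚ ε ≤ 1ℚ →
    0ℚ +ℚ (½ *ℚ ε) *ℚ (½ *ℚ ε) ≤ norm (1ℚ +ℚ -ℚ a) (0ℚ +ℚ -ℚ b)
  norm-1- {ε} a b 0<ε p = ℚ.≤-trans (ℚ.≤-reflexive (ℚ.+-identityˡ (δ *ℚ δ)))
    (ℚ.≤-trans (*-mono 0≤δ (ℚ.≤-trans 0≤δ δ≤1-a) δ≤1-a δ≤1-a)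
      (≤-by ((0ℚ +ℚ -ℚ b) *ℚ (0ℚ +ℚ -ℚ b)) (0≤a² (0ℚ +ℚ -ℚ b)) refl))
    where
    δ = ½ *ℚ ε
    0≤δ : 0ℚ ≤ δ
    0≤δ = 0≤* (ℚ.<⇒≤ 0<½) (ℚ.<⇒≤ 0<ε)
    δ≤1-a : δ ≤ 1ℚ +ℚ -ℚ a
    δ≤1-a = ≤-by
      (½ *ℚ ((1ℚ -ℚ a) *ℚ (1ℚ -ℚ a) +ℚ b *ℚ b +ℚ (1ℚ -ℚ (norm a b +ℚ ε))))
      (0≤* (ℚ.<⇒≤ 0<½) (0≤+ (0≤+ (0≤a² (1ℚ -ℚ a)) (0≤a² b)) (0≤b-a p)))
      (solve 3 (λ a b e →
        con ½ :* e :+ con ½ :* ((con 1ℚ :- a) :* (con 1ℚ :- a) :+ b :* b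
          :+ (con 1ℚ :- (a :* a :+ b :* b :+ e)))
        := con 1ℚ :+ :- a) refl a b ε)

  ∣z∣<1⇒∣z∣²<1 : ∀ z → ∣ z ∣ <ᵣ 1ᵣ → ∣ z ∣² <ᵣ 1ᵣ
  ∣z∣<1⇒∣z∣²<1 z (η , 0<η , s+η≤1) = ½ *ℚ η , 0<½η , ∀∞-map₂
    (λ n s+η≤1 e≤½η → square<1 0<η
      (0≤√-approx (0≤∣z∣² n) n) (0≤√-error (0≤∣z∣² n) n) e≤½η s+η≤1
      (√-upper (0≤∣z∣² n) n))
    s+η≤1 (√-error-small {seq ∣ z ∣²} (cauchy ∣ z ∣²) 0≤∣z∣² 0<½η)
    where
    0<½η : 0ℚ < ½ *ℚ η
    0<½η = 0<* 0<½ 0<η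
    0≤∣z∣² : ∀ n → 0ℚ ≤ seq ∣ z ∣² n
    0≤∣z∣² n = 0≤norm (seq (re z) n) (seq (im z) n)

  ∣-z∣²<1 : ∀ z → ∣ z ∣² <ᵣ 1ᵣ → ∣ - z ∣² <ᵣ 1ᵣ
  ∣-z∣²<1 z (ε , 0<ε , p) = ε , 0<ε , ∀∞-map
    (λ n → subst (λ a → a +ℚ ε ≤ 1ℚ) (norm-neg (seq (re z) n) (seq (im z) n))) p

  ∣zw∣²<1 : ∀ z w → ∣ z ∣² <ᵣ 1ᵣ → ∀∞ (λ n → seq ∣ w ∣² n ≤ 1ℚ) → ∣ z * w ∣² <ᵣ 1ᵣ
  ∣zw∣²<1 z w (ε , 0<ε , p) q = ε , 0<ε , ∀∞-map₂
    (λ n p q →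
      let a = seq (re z) n
          b = seq (im z) n
          c = seq (re w) n
          d = seq (im w) n
      in ℚ.≤-trans
        (ℚ.+-monoˡ-≤ ε (subst₂ _≤_ (norm-* a b c d) (ℚ.*-identityʳ (norm a b))
          (*-mono (0≤norm a b) (ℚ.<⇒≤ 0<1) ℚ.≤-refl q)))
        p)
    p q

  ∣z∣²≤1 : ∀ z → ∣ z ∣² <ᵣ 1ᵣ → ∀∞ (λ n → seq ∣ z ∣² n ≤ 1ℚ)
  ∣z∣²≤1 z (ε , 0<ε , p) = ∀∞-map (λ n → ℚ.≤-trans (≤-by ε (ℚ.<⇒≤ 0<ε) refl)) p

  ∣z^k∣²≤1 : ∀ z → ∣ z ∣² <ᵣ 1ᵣ → ∀ k → ∀∞ (λ n → seq ∣ z ^ k ∣² n ≤ 1ℚ)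
  ∣z^k∣²≤1 z _ zero    = 0 , λ _ _ → ℚ.≤-refl
  ∣z^k∣²≤1 z p (suc k) =
    ∣z∣²≤1 (z * z ^ k) (∣zw∣²<1 z (z ^ k) p (∣z^k∣²≤1 z p k))

  1-z≉0 : ∀ z → ∣ z ∣² <ᵣ 1ᵣ → 1# - z ≉0
  1-z≉0 z (ε , 0<ε , p) = (½ *ℚ ε) *ℚ (½ *ℚ ε) , 0<* (0<* 0<½ 0<ε) (0<* 0<½ 0<ε) ,
    ∀∞-map (λ n → norm-1- (seq (re z) n) (seq (im z) n) 0<ε) p

  1≉0 : 1# ≉0
  1≉0 = 1ℚ , 0<1 , 0 , λ _ _ → ℚ.≤-refl

  *-≉0 : ∀ z w → z ≉0 → w ≉0 → z * w ≉0
  *-≉0 z w (ε , 0<ε , p) (δ , 0<δ , q) = ε *ℚ δ , 0<* 0<ε 0<δ , ∀∞-map₂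
    (λ n p q →
      let a = seq (re z) n
          b = seq (im z) n
          c = seq (re w) n
          d = seq (im w) n
      in subst₂ _≤_ (sym (ℚ.+-identityˡ (ε *ℚ δ))) (norm-* a b c d)
        (*-mono (ℚ.<⇒≤ 0<ε) (0≤norm c d)
          (subst (_≤ norm a b) (ℚ.+-identityˡ ε) p)
          (subst (_≤ norm c d) (ℚ.+-identityˡ δ) q)))
    p q

  product-≉0 : ∀ {n} (f : Fin n → ℂ) → (∀ i → f i ≉0) → product f ≉0
  product-≉0 {zero}  f p = 1≉0
  product-≉0 {suc n} f p = *-≉0 (f Fin.zero) (product (λ i → f (Fin.suc i)))
    (p Fin.zero) (product-≉0 (λ i → f (Fin.suc i)) (λ i → p (Fin.suc i)))

open ℂ-Lemmas

-- ⟨ x ⨾ p ⟩ n is the q-Pochhammer symbol (x; p)ₙ.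
⟨_⨾_⟩_ : ℂ → ℂ → ℕ → ℂ
⟨ x ⨾ p ⟩ n = product λ (i : Fin n) → 1# - x * p ^ toℕ i

pochhammer-≉0 : ∀ x p n → ∣ x ∣² <ᵣ 1ᵣ → ∣ p ∣² <ᵣ 1ᵣ → ⟨ x ⨾ p ⟩ n ≉0
pochhammer-≉0 x p n ∣x∣²<1 ∣p∣²<1 = product-≉0 (λ (i : Fin n) → 1# - x * p ^ toℕ i)
  λ i → 1-z≉0 (x * p ^ toℕ i)
    (∣zw∣²<1 x (p ^ toℕ i) ∣x∣²<1 (∣z^k∣²≤1 p ∣p∣²<1 (toℕ i)))

module _ (q : ℂ) (∣q∣<1 : ∣ q ∣ <ᵣ 1ᵣ) where

  ∣q∣²<1 : ∣ q ∣² <ᵣ 1ᵣ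
  ∣q∣²<1 = ∣z∣<1⇒∣z∣²<1 q ∣q∣<1

  ⟨q⨾q⟩≉0 : ∀ n → ⟨ q ⨾ q ⟩ n ≉0
  ⟨q⨾q⟩≉0 n = pochhammer-≉0 q q n ∣q∣²<1 ∣q∣²<1

  ⟨-q⨾q⟩≉0 : ∀ n → ⟨ - q ⨾ q ⟩ n ≉0
  ⟨-q⨾q⟩≉0 n = pochhammer-≉0 (- q) q n (∣-z∣²<1 q ∣q∣²<1) ∣q∣²<1

  -- Only meaningful for k ≤ n, as n ∸ k is truncated.
  qBinomial : ℕ → ℕ → ℂ
  qBinomial n k = ⟨ q ⨾ q ⟩ n / ⟨ q ⨾ q ⟩ (n ℕ.∸ k) * ⟨ q ⨾ q ⟩ k
    ⟨ *-≉0 (⟨ q ⨾ q ⟩ (n ℕ.∸ k)) (⟨ q ⨾ q ⟩ k) (⟨q⨾q⟩≉0 (n ℕ.∸ k)) (⟨q⨾q⟩≉0 k) ⟩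

  U : ℕ → ℂ → ℂ
  U m x = sum λ (i : Fin (suc m)) → let k = toℕ i in
    qBinomial (m ℕ.+ k) k * (x ^ k / ⟨ - q ⨾ q ⟩ k ⟨ ⟨-q⨾q⟩≉0 k ⟩)

{-# OPTIONS --safe #-}
-- Write U_m(x) = Σ_{k≤m} c_k x^k with c_k = [m+k choose k]_q / (-q;q)_k. The coefficients satisfy
-- c_{k+1} (1 - q^{2k+2}) = c_k (1 - q^{m+k+1}), so the functional equation for
-- the sum over k ≤ n holds up to the boundary term x^{n+1} c_n (1 - q^{m+n+1}).
-- At n = m this term is the stated one, because (q;q)_{2m} = (q;q²)_m (q²;q²)_m
-- and (q²;q²)_m = (q;q)_m (-q;q)_m give c_m (q;q)_m = (q;q²)_m.
module Submission where

open import Algebra.Bundles using (CommutativeRing; Monoid; Semiring)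
open import Algebra.Bundles.Raw using (RawRing)
import Algebra.Definitions.RawMonoid as RawMonoidDefinitions
import Algebra.Definitions.RawSemiring as RawSemiringDefinitions
import Algebra.Properties.AbelianGroup as AbelianGroupProperties
import Algebra.Properties.CommutativeMonoid.Sum as CommutativeMonoidSum
import Algebra.Properties.CommutativeSemiring.Exp as CommutativeExp
import Algebra.Properties.Ring as RingProperties
import Algebra.Properties.Semiring.Exp as Exp
import Algebra.Solver.Ring.NaturalCoefficients.Default as NaturalCoefficients
open import Algebra.Structures using (IsCommutativeRing)
open import Data.Fin.Base using (Fin; toℕ)
open import Data.Nat.Base as ℕ using (ℕ; zero; suc)
import Data.Nat.Properties as ℕ
open import Data.Product.Base using (_,_)
open import Data.Rational.Base as ℚ using (0ℚ; 1ℚ; ½)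
import Data.Rational.Properties as ℚ
open import Data.Rational.Solver using (module +-*-Solver)
open import Function.Base using (_∘_)
open import Level using (0ℓ; _⊔_)
import Relation.Binary.Reasoning.Setoid as SetoidReasoning
open import Relation.Binary.PropositionalEquality as ≡ using (_≡_; cong; subst)

-- Finite sums in a monoid.

module _ {c ℓ} (M : Monoid c ℓ) where
  open Monoid M
  open RawMonoidDefinitions rawMonoid using (sum)

  -- `sum` unfolds at its first index, while the inductions below append a top term. An arbitrary
  -- monoid lets the lemma serve both for sums (`S-suc`) and for products (`product-last`).
  sum-last : ∀ (f : ℕ → Carrier) n →
    sum (λ (i : Fin (suc n)) → f (toℕ i)) ≈ sum (λ (i : Fin n) → f (toℕ i)) ∙ f n
  sum-last f zero    = trans (identityʳ (f 0)) (sym (identityˡ (f 0)))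
  sum-last f (suc n) = trans (∙-congˡ (sum-last (f ∘ suc) n)) (sym (assoc _ _ _))

-- A record, so that two presentations of the same ring operations are compared
-- operation by operation: comparing the unfolded equations over ℂ is infeasible.
-- Subtraction is only given up to _≈_ for the same reason: comparing _-_ on ℂ with
-- the derived subtraction of a ring would unfold proofs of Cauchyness.
-- In the paper's notation: B k = [m+k choose k]_q, y k x = x^k / (-q;q)_k, V = U_m and
-- e = (q;q²)_{m+1} / (q;q)_m.
record FunctionalEquation {r ℓ} {A : Set r}
  (_≈_ : A → A → Set ℓ) (_+_ _*_ : A → A → A) (-_ : A → A) (1# : A)
  (_^_ : A → ℕ → A) (sum : ∀ {n} → (Fin n → A) → A) : Set (r ⊔ ℓ) where
  field
    equation :
      (_-_ : A → A → A)
      (minus-def : ∀ x y → (x - y) ≈ (x + (- y)))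
      (pochhammer : A → A → ℕ → A)
      (pochhammer-zero : ∀ x p → pochhammer x p 0 ≈ 1#)
      (pochhammer-suc : ∀ x p n →
        pochhammer x p (suc n) ≈ (pochhammer x p n * (1# - (x * (p ^ n)))))
      (q : A)
      (Q⁻¹ P⁻¹ : ℕ → A)
      (Q⁻¹*Q≈1 : ∀ n → (Q⁻¹ n * pochhammer q q n) ≈ 1#)
      (P⁻¹*P≈1 : ∀ n → (P⁻¹ n * pochhammer (- q) q n) ≈ 1#)
      (m : ℕ) (B : ℕ → A)
      (B-def : ∀ k →
        (B k * (pochhammer q q m * pochhammer q q k)) ≈ pochhammer q q (m ℕ.+ k))
      (y : ℕ → A → A)
      (y-def : ∀ k x → (y k x * pochhammer (- q) q k) ≈ (x ^ k))
      (V : A → A)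
      (V-def : ∀ x → V x ≡ sum (λ (i : Fin (suc m)) → B (toℕ i) * y (toℕ i) x)) →
      ∀ x e → (e * pochhammer q q m) ≈ pochhammer q (q ^ 2) (suc m) →
      V (x * (q ^ 2))
        ≈ ((((1# - x) * V x) + ((x * (q ^ suc m)) * V (x * q))) + ((x ^ suc m) * e))

-- The q-series argument over a commutative ring: differences and cancellation.

module QSeries {r ℓ} (R : CommutativeRing r ℓ) where
  open CommutativeRing R
  open RawSemiringDefinitions (Semiring.rawSemiring semiring) using (_^_; sum)
  open AbelianGroupProperties +-abelianGroup using (xyx⁻¹≈y; ⁻¹-involutive)
  open RingProperties ring using (-‿distribˡ-*)
  open CommutativeMonoidSum +-commutativeMonoid using (sum-cong-≋)
  open CommutativeExp commutativeSemiring using (^-distrib-*)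
  open Exp semiring using (^-homo-*; ^-congˡ; ^-congʳ)
  open NaturalCoefficients commutativeSemiring
  open SetoidReasoning setoid

  -- The solver works in commutative semirings, so a difference `1# - x` is an opaque atom to it.
  -- This relation is what eliminates such atoms between solver calls.
  x+[1-x]≈1 : ∀ x → x + (1# - x) ≈ 1#
  x+[1-x]≈1 x = trans (sym (+-assoc x 1# (- x))) (xyx⁻¹≈y x 1#)

  1-‿cong : ∀ {x y} → x ≈ y → 1# - x ≈ 1# - y
  1-‿cong = +-congˡ ∘ -‿cong

  x+y≈1⇒y≈1-x : ∀ {x y} → x + y ≈ 1# → y ≈ 1# - x
  x+y≈1⇒y≈1-x {x} {y} eq = trans (sym (xyx⁻¹≈y x y)) (+-congʳ eq)

  [1-x][1+x]≈1-x² : ∀ x → (1# - x) * (1# + x) ≈ 1# - x * x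
  [1-x][1+x]≈1-x² x = x+y≈1⇒y≈1-x (begin
    x * x + y * (1# + x)
      ≈⟨ solve 2 (λ x y → x :* x :+ y :* (con 1 :+ x) := y :+ x :* (x :+ y)) refl x y ⟩
    y + x * (x + y)  ≈⟨ +-congˡ (*-congˡ (x+[1-x]≈1 x)) ⟩
    y + x * 1#       ≈⟨ solve 2 (λ x y → y :+ x :* con 1 := x :+ y) refl x y ⟩
    x + y            ≈⟨ x+[1-x]≈1 x ⟩
    1#               ∎)
    where y = 1# - x

  -- Stands in for division: quotients enter only through the products that define them, and
  -- identities between them are proved after clearing denominators.
  Cancellable : Carrier → Set _
  Cancellable z = ∀ {x y} → x * z ≈ y * z → x ≈ y

  *-cancellable : ∀ {z w} → Cancellable z → Cancellable w → Cancellable (z * w)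
  *-cancellable cz cw eq = cz (cw (trans (*-assoc _ _ _) (trans eq (sym (*-assoc _ _ _)))))

  inverse⇒cancellable : ∀ w z → w * z ≈ 1# → Cancellable z
  inverse⇒cancellable w z wz≈1 {x} {y} xz≈yz = begin
    x            ≈⟨ restore x ⟨
    x * z * w    ≈⟨ *-congʳ xz≈yz ⟩
    y * z * w    ≈⟨ restore y ⟩
    y            ∎
    where
    restore : ∀ a → a * z * w ≈ a
    restore a = begin
      a * z * w    ≈⟨ solve 3 (λ a z w → a :* z :* w := a :* (w :* z)) refl a z w ⟩
      a * (w * z)  ≈⟨ *-congˡ wz≈1 ⟩
      a * 1#       ≈⟨ *-identityʳ a ⟩
      a            ∎

  -- q-Pochhammer products.

  module _
    (pochhammer : Carrier → Carrier → ℕ → Carrier)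
    (pochhammer-zero : ∀ x p → pochhammer x p 0 ≈ 1#)
    (pochhammer-suc : ∀ x p n →
      pochhammer x p (suc n) ≈ pochhammer x p n * (1# - x * p ^ n))
    (q : Carrier)
    where

    Q P O : ℕ → Carrier
    Q = pochhammer q q
    P = pochhammer (- q) q
    O = pochhammer q (q ^ 2)

    Q-suc : ∀ n → Q (suc n) ≈ Q n * (1# - q ^ suc n)
    Q-suc = pochhammer-suc q q

    P-suc : ∀ n → P (suc n) ≈ P n * (1# + q ^ suc n)
    P-suc n = trans (pochhammer-suc (- q) q n) (*-congˡ (+-congˡ (begin
      - (- q * q ^ n)    ≈⟨ -‿cong (sym (-‿distribˡ-* q (q ^ n))) ⟩
      - (- (q * q ^ n))  ≈⟨ ⁻¹-involutive (q * q ^ n) ⟩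
      q ^ suc n          ∎)))

    O-suc : ∀ n → O (suc n) ≈ O n * (1# - q ^ suc (n ℕ.+ n))
    O-suc n = trans (pochhammer-suc q (q ^ 2) n)
      (*-congˡ (1-‿cong (*-congˡ (begin
        (q ^ 2) ^ n          ≈⟨ ^-distrib-* q (q ^ 1) n ⟩
        q ^ n * (q ^ 1) ^ n  ≈⟨ *-congˡ (^-congˡ n (*-identityʳ q)) ⟩
        q ^ n * q ^ n        ≈⟨ ^-homo-* q n n ⟨
        q ^ (n ℕ.+ n)        ∎))))

    -- `Q n * P n` plays the role of (q²;q²)_n; its new factor is a difference of squares.
    QP-suc : ∀ n → Q (suc n) * P (suc n) ≈ Q n * P n * (1# - q ^ suc n * q ^ suc n)
    QP-suc n = begin
      Q (suc n) * P (suc n)  ≈⟨ *-cong (Q-suc n) (P-suc n) ⟩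
      Q n * (1# - y) * (P n * (1# + y))
        ≈⟨ solve 4 (λ a b c d → a :* b :* (c :* d) := a :* c :* (b :* d))
             refl (Q n) (1# - y) (P n) (1# + y) ⟩
      Q n * P n * ((1# - y) * (1# + y))  ≈⟨ *-congˡ ([1-x][1+x]≈1-x² y) ⟩
      Q n * P n * (1# - y * y)           ∎
      where y = q ^ suc n

    -- Splits (q;q)_{2n} by the parity of the exponent. Each induction step adds the exponents 2n+1,
    -- absorbed by `O`, and 2n+2, absorbed by `Q` and `P` through `QP-suc`.
    Q-double : ∀ n → Q (n ℕ.+ n) ≈ O n * (Q n * P n)
    Q-double zero    = begin
      Q 0                ≈⟨ pochhammer-zero q q ⟩
      1#                 ≈⟨ solve 0 (con 1 := con 1 :* (con 1 :* con 1)) refl ⟩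
      1# * (1# * 1#)
        ≈⟨ *-cong (pochhammer-zero q (q ^ 2))
             (*-cong (pochhammer-zero q q) (pochhammer-zero (- q) q)) ⟨
      O 0 * (Q 0 * P 0)  ∎
    Q-double (suc n) = begin
      Q (suc n ℕ.+ suc n)  ≈⟨ Q-suc (n ℕ.+ suc n) ⟩
      Q (n ℕ.+ suc n) * (1# - q ^ (suc n ℕ.+ suc n))
        ≈⟨ *-cong
             (trans (reflexive (cong Q (ℕ.+-suc n n)))
               (trans (Q-suc (n ℕ.+ n)) (*-congʳ (Q-double n))))
             (1-‿cong (^-homo-* q (suc n) (suc n))) ⟩
      O n * (Q n * P n) * a * b
        ≈⟨ solve 4 (λ o r a b → o :* r :* a :* b := o :* a :* (r :* b))
             refl (O n) (Q n * P n) a b ⟩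
      O n * a * (Q n * P n * b)  ≈⟨ *-cong (O-suc n) (QP-suc n) ⟨
      O (suc n) * (Q (suc n) * P (suc n)) ∎
      where
      a = 1# - q ^ suc (n ℕ.+ n)
      b = 1# - q ^ suc n * q ^ suc n

    -- The coefficients of U_m.

    module Coefficients
      (Q⁻¹ P⁻¹ : ℕ → Carrier)
      (Q⁻¹*Q≈1 : ∀ n → Q⁻¹ n * Q n ≈ 1#)
      (P⁻¹*P≈1 : ∀ n → P⁻¹ n * P n ≈ 1#)
      (m : ℕ) (B : ℕ → Carrier)
      (B-def : ∀ k → B k * (Q m * Q k) ≈ Q (m ℕ.+ k))
      where

      Q-cancellable : ∀ n → Cancellable (Q n)
      Q-cancellable n = inverse⇒cancellable (Q⁻¹ n) (Q n) (Q⁻¹*Q≈1 n)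

      P-cancellable : ∀ n → Cancellable (P n)
      P-cancellable n = inverse⇒cancellable (P⁻¹ n) (P n) (P⁻¹*P≈1 n)

      c : ℕ → Carrier
      c k = B k * P⁻¹ k

      c-def : ∀ k → c k * (Q m * (Q k * P k)) ≈ Q (m ℕ.+ k)
      c-def k = begin
        B k * P⁻¹ k * (Q m * (Q k * P k))
          ≈⟨ solve 5 (λ b p s r t → b :* p :* (s :* (r :* t)) := p :* t :* (b :* (s :* r)))
               refl (B k) (P⁻¹ k) (Q m) (Q k) (P k) ⟩
        P⁻¹ k * P k * (B k * (Q m * Q k))  ≈⟨ *-cong (P⁻¹*P≈1 k) (B-def k) ⟩
        1# * Q (m ℕ.+ k)                   ≈⟨ *-identityˡ _ ⟩
        Q (m ℕ.+ k)                        ∎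

      -- Multiplied by `Q m * (Q k * P k)`, both sides become (q;q)_{m+k+1}: on the left the factor
      -- raises `Q k * P k` to index k+1, on the right it extends `Q (m + k)`.
      c-suc : ∀ k →
        c (suc k) * (1# - q ^ suc k * q ^ suc k) ≈ c k * (1# - q ^ suc (m ℕ.+ k))
      c-suc k = *-cancellable (Q-cancellable m)
        (*-cancellable (Q-cancellable k) (P-cancellable k)) (begin
        c (suc k) * b * (Q m * (Q k * P k))
          ≈⟨ solve 4 (λ c b s r → c :* b :* (s :* r) := c :* (s :* (r :* b)))
               refl (c (suc k)) b (Q m) (Q k * P k) ⟩
        c (suc k) * (Q m * (Q k * P k * b))  ≈⟨ *-congˡ (*-congˡ (QP-suc k)) ⟨
        c (suc k) * (Q m * (Q (suc k) * P (suc k)))  ≈⟨ c-def (suc k) ⟩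
        Q (m ℕ.+ suc k)  ≈⟨ reflexive (cong Q (ℕ.+-suc m k)) ⟩
        Q (suc (m ℕ.+ k))  ≈⟨ Q-suc (m ℕ.+ k) ⟩
        Q (m ℕ.+ k) * a  ≈⟨ *-congʳ (c-def k) ⟨
        c k * (Q m * (Q k * P k)) * a
          ≈⟨ solve 3 (λ c r a → c :* r :* a := c :* a :* r)
               refl (c k) (Q m * (Q k * P k)) a ⟩
        c k * a * (Q m * (Q k * P k)) ∎)
        where
        a = 1# - q ^ suc (m ℕ.+ k)
        b = 1# - q ^ suc k * q ^ suc k

      -- At k = m, `c-def` and `Q-double` give two expressions for (q;q)_{2m}; cancel `Q m * P m`.
      c-top : c m * Q m ≈ O m
      c-top = *-cancellable (Q-cancellable m) (P-cancellable m)
        (trans (*-assoc _ _ _) (trans (c-def m) (Q-double m)))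

      -- Truncated sums and their functional equation.

      -- The length `n` is independent of the `m` fixed inside `c`, which allows induction on `n`;
      -- U_m is the case n = m+1.
      S : ℕ → Carrier → Carrier
      S n x = sum λ (i : Fin n) → c (toℕ i) * x ^ toℕ i

      S-suc : ∀ n x → S (suc n) x ≈ S n x + c n * x ^ n
      S-suc n x = sum-last +-monoid (λ k → c k * x ^ k) n

      -- Inserting `P⁻¹ k * P k` moves the denominator from `y k` into the coefficient `c k`.
      sum≈S : ∀ n x (y : ℕ → Carrier) → (∀ k → y k * P k ≈ x ^ k) →
        sum (λ (i : Fin n) → B (toℕ i) * y (toℕ i)) ≈ S n x
      sum≈S n x y y-def = sum-cong-≋ {n} (λ i → term (toℕ i))
        where
        term : ∀ k → B k * y k ≈ c k * x ^ k
        term k = begin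
          B k * y k                    ≈⟨ *-congˡ (*-identityʳ (y k)) ⟨
          B k * (y k * 1#)             ≈⟨ *-congˡ (*-congˡ (P⁻¹*P≈1 k)) ⟨
          B k * (y k * (P⁻¹ k * P k))
            ≈⟨ solve 4 (λ b y p r → b :* (y :* (p :* r)) := b :* p :* (y :* r))
                 refl (B k) (y k) (P⁻¹ k) (P k) ⟩
          B k * P⁻¹ k * (y k * P k)    ≈⟨ *-congˡ (y-def k) ⟩
          c k * x ^ k                  ∎

      -- Used with t = c_k x^k and w = q^{m+1+k}: the summands are the contributions of t to (1-x)
      -- U_m(x) and to x q^{m+1} U_m(xq), and the boundary term left over.
      term-equation : ∀ x t w → t ≈ (1# - x) * t + x * (w * t) + x * (t * (1# - w))
      term-equation x t w = sym (begin
        d * t + x * (w * t) + x * (t * e)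
          ≈⟨ solve 5 (λ x t w d e →
               d :* t :+ x :* (w :* t) :+ x :* (t :* e) := (x :* (w :+ e) :+ d) :* t)
               refl x t w d e ⟩
        (x * (w + e) + d) * t  ≈⟨ *-congʳ (+-congʳ (*-congˡ (x+[1-x]≈1 w))) ⟩
        (x * 1# + d) * t       ≈⟨ *-congʳ (+-congʳ (*-identityʳ x)) ⟩
        (x + d) * t            ≈⟨ *-congʳ (x+[1-x]≈1 x) ⟩
        1# * t                 ≈⟨ *-identityˡ t ⟩
        t                      ∎)
        where
        d = 1# - x
        e = 1# - w

      -- Induction on `n`: the boundary term of the previous stage merges with the new term on the
      -- left into c_{n+1} x^{n+1}, which `term-equation` splits into the new terms on the right and
      -- the next boundary term.
      S-functional : ∀ n x →
        S (suc n) (x * q ^ 2)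
          ≈ (1# - x) * S (suc n) x + x * q ^ suc m * S (suc n) (x * q)
            + x ^ suc n * (c n * (1# - q ^ suc (m ℕ.+ n)))
      S-functional zero x = begin
        c 0 * 1# + 0#  ≈⟨ trans (+-identityʳ _) (*-identityʳ _) ⟩
        -- Only the constant term is present, so w is q^{m+1} itself.
        c 0            ≈⟨ term-equation x (c 0) u ⟩
        d * c 0 + x * (u * c 0) + x * (c 0 * (1# - u))
          ≈⟨ +-congˡ (*-congˡ (*-congˡ (1-‿cong
               (^-congʳ q (cong suc (≡.sym (ℕ.+-identityʳ m))))))) ⟩
        d * c 0 + x * (u * c 0) + x * (c 0 * e)
          ≈⟨ solve 5 (λ x t u d e →
               d :* t :+ x :* (u :* t) :+ x :* (t :* e) :=
               d :* (t :* con 1 :+ con 0) :+ x :* u :* (t :* con 1 :+ con 0)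
                 :+ x :* con 1 :* (t :* e))
               refl x (c 0) u d e ⟩
        d * (c 0 * 1# + 0#) + x * u * (c 0 * 1# + 0#) + x * 1# * (c 0 * e) ∎
        where
        u = q ^ suc m
        d = 1# - x
        e = 1# - q ^ suc (m ℕ.+ 0)
      S-functional (suc n) x = begin
        S (suc (suc n)) (x * q ^ 2)  ≈⟨ S-suc (suc n) (x * q ^ 2) ⟩
        S (suc n) (x * q ^ 2) + c′ * (x * q ^ 2) ^ suc n
          ≈⟨ +-cong (S-functional n x) (*-congˡ [xq²]^) ⟩
        d * s₀ + x * u * s₁ + X * (c n * (1# - q ^ suc (m ℕ.+ n))) + c′ * (X * (y * y))
          -- The old boundary term now carries 1 - q^{2n+2}, the complement of the factor q^{2n+2}
          -- in the new term.
          ≈⟨ +-congʳ (+-congˡ (*-congˡ (c-suc n))) ⟨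
        d * s₀ + x * u * s₁ + X * (c′ * (1# - y * y)) + c′ * (X * (y * y))
          ≈⟨ solve 5 (λ r X c z e →
               r :+ X :* (c :* e) :+ c :* (X :* z) := r :+ c :* X :* (z :+ e))
               refl (d * s₀ + x * u * s₁) X c′ (y * y) (1# - y * y) ⟩
        d * s₀ + x * u * s₁ + c′ * X * (y * y + (1# - y * y))
          ≈⟨ +-congˡ (trans (*-congˡ (x+[1-x]≈1 (y * y))) (*-identityʳ _)) ⟩
        d * s₀ + x * u * s₁ + c′ * X
          ≈⟨ +-congˡ (term-equation x (c′ * X) (u * y)) ⟩
        d * s₀ + x * u * s₁
          + (d * (c′ * X) + x * (u * y * (c′ * X)) + x * (c′ * X * (1# - u * y)))
          ≈⟨ solve 9 (λ d s x u t c X y e →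
               d :* s :+ x :* u :* t
                 :+ (d :* (c :* X) :+ x :* (u :* y :* (c :* X)) :+ x :* (c :* X :* e)) :=
               d :* (s :+ c :* X) :+ x :* u :* (t :+ c :* (X :* y)) :+ x :* X :* (c :* e))
               refl d s₀ x u s₁ c′ X y (1# - u * y) ⟩
        d * (s₀ + c′ * X) + x * u * (s₁ + c′ * (X * y)) + x * X * (c′ * (1# - u * y))
          ≈⟨ +-cong (+-cong
               (*-congˡ (S-suc (suc n) x))
               (*-congˡ (trans (S-suc (suc n) (x * q))
                 (+-congˡ (*-congˡ (^-distrib-* x q (suc n)))))))
               (*-congˡ (*-congˡ (1-‿cong (^-homo-* q (suc m) (suc n))))) ⟨
        d * S (suc (suc n)) x + x * u * S (suc (suc n)) (x * q)
          + x ^ suc (suc n) * (c′ * (1# - q ^ suc (m ℕ.+ suc n))) ∎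
        where
        u = q ^ suc m
        d = 1# - x
        c′ = c (suc n)
        s₀ = S (suc n) x
        s₁ = S (suc n) (x * q)
        X = x ^ suc n
        y = q ^ suc n
        [xq²]^ : (x * q ^ 2) ^ suc n ≈ X * (y * y)
        [xq²]^ = begin
          (x * q ^ 2) ^ suc n    ≈⟨ ^-distrib-* x (q ^ 2) (suc n) ⟩
          X * (q ^ 2) ^ suc n    ≈⟨ *-congˡ (^-distrib-* q (q ^ 1) (suc n)) ⟩
          X * (y * (q ^ 1) ^ suc n)
            ≈⟨ *-congˡ (*-congˡ (^-congˡ (suc n) (*-identityʳ q))) ⟩
          X * (y * y)            ∎

      V-functional : ∀ (V : Carrier → Carrier) → (∀ x → V x ≈ S (suc m) x) →
        ∀ x e → e * Q m ≈ O (suc m) →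
        V (x * q ^ 2)
          ≈ (1# - x) * V x + x * q ^ suc m * V (x * q) + x ^ suc m * e
      V-functional V V≈S x e e-def = begin
        V (x * q ^ 2)          ≈⟨ V≈S (x * q ^ 2) ⟩
        S (suc m) (x * q ^ 2)  ≈⟨ S-functional m x ⟩
        (1# - x) * S (suc m) x + x * q ^ suc m * S (suc m) (x * q) + x ^ suc m * (c m * a)
          ≈⟨ +-cong (+-cong (*-congˡ (V≈S x)) (*-congˡ (V≈S (x * q)))) (*-congˡ e≈c*a) ⟨
        (1# - x) * V x + x * q ^ suc m * V (x * q) + x ^ suc m * e ∎
        where
        a = 1# - q ^ suc (m ℕ.+ m)
        e≈c*a : e ≈ c m * a
        -- `e` is known only through `e * Q m`, so the comparison is made after multiplying by
        -- `Q m`, where `c-top` applies.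
        e≈c*a = Q-cancellable m (begin
          e * Q m        ≈⟨ e-def ⟩
          O (suc m)      ≈⟨ O-suc m ⟩
          O m * a        ≈⟨ *-congʳ c-top ⟨
          c m * Q m * a
            ≈⟨ solve 3 (λ c r a → c :* r :* a := c :* a :* r) refl (c m) (Q m) a ⟩
          c m * a * Q m  ∎)

  functional-equation : FunctionalEquation
    _≈_ _+_ _*_ -_ 1# _^_ (λ {n} → sum {n})
  functional-equation = record
    { equation = λ _∸_ minus-def poch poch-zero poch-suc q Q⁻¹ P⁻¹ Q⁻¹*Q≈1 P⁻¹*P≈1
        m B B-def y y-def V V-def x e e-def →
        let open Coefficients poch poch-zero
              (λ x p n → trans (poch-suc x p n) (*-congˡ (minus-def 1# (x * p ^ n))))
              q Q⁻¹ P⁻¹ Q⁻¹*Q≈1 P⁻¹*P≈1 m B B-def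
            V≈S = λ z →
              trans (reflexive (V-def z)) (sum≈S (suc m) z (λ k → y k z) (λ k → y-def k z))
        in trans (V-functional V V≈S x e e-def)
             (+-congʳ (+-congʳ (*-congʳ (sym (minus-def 1# x)))))
    }

-- The complex numbers as a commutative ring with quotients.

open import Defs
open Defs.Rational using (*-mono; 0<*; 0<½; ∣a-b∣≡∣b-a∣; _⁻¹; *-⁻¹)
open Defs.Operations using (bounded; ∣ac-bd∣; tolerance)
open Defs.ℂ-Lemmas using (norm; *-≉0)

module _ where
  open +-*-Solver

  -- Arguments x, y of _≈ᵣ_ and _≈_ are explicit because both relations unfold and
  -- their arguments cannot be inferred.
  ≡⇒≈ᵣ : ∀ x y → ∀∞ (λ n → seq x n ≡ seq y n) → x ≈ᵣ y
  ≡⇒≈ᵣ x y p {ε} 0<ε = ∀∞-map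
    (λ n eq → subst (ℚ._< ε)
      (≡.sym (cong ℚ.∣_∣ (≡.trans (cong (ℚ._- seq y n) eq) (ℚ.+-inverseʳ (seq y n))))) 0<ε)
    p

  ≈ᵣ-sym : ∀ x y → x ≈ᵣ y → y ≈ᵣ x
  ≈ᵣ-sym x y p {ε} 0<ε =
    ∀∞-map (λ n → subst (ℚ._< ε) (∣a-b∣≡∣b-a∣ (seq x n) (seq y n))) (p 0<ε)

  -- The ε/2 argument; the equation regroups a difference as a sum of two small ones.
  ∣+∣<ε : ∀ a b {c ε} → a ℚ.+ b ≡ c →
    ℚ.∣ a ∣ ℚ.< ½ ℚ.* ε → ℚ.∣ b ∣ ℚ.< ½ ℚ.* ε → ℚ.∣ c ∣ ℚ.< ε
  ∣+∣<ε a b {ε = ε} ≡.refl p q = ℚ.≤-<-trans (ℚ.∣p+q∣≤∣p∣+∣q∣ a b)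
    (subst (ℚ.∣ a ∣ ℚ.+ ℚ.∣ b ∣ ℚ.<_)
      (solve 1 (λ e → con ½ :* e :+ con ½ :* e := e) ≡.refl ε) (ℚ.+-mono-< p q))

  ≈ᵣ-trans : ∀ x y z → x ≈ᵣ y → y ≈ᵣ z → x ≈ᵣ z
  ≈ᵣ-trans x y z p q 0<ε = ∀∞-map₂
    (λ n → ∣+∣<ε (seq x n ℚ.- seq y n) (seq y n ℚ.- seq z n)
      (solve 3 (λ a b c → a :- b :+ (b :- c) := a :- c) ≡.refl (seq x n) (seq y n) (seq z n)))
    (p (0<* 0<½ 0<ε)) (q (0<* 0<½ 0<ε))

  +ᵣ-cong : ∀ x y u v → x ≈ᵣ y → u ≈ᵣ v → x +ᵣ u ≈ᵣ y +ᵣ v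
  +ᵣ-cong x y u v p q 0<ε = ∀∞-map₂
    (λ n → ∣+∣<ε (seq x n ℚ.- seq y n) (seq u n ℚ.- seq v n)
      (solve 4 (λ a b c d → a :- b :+ (c :- d) := a :+ c :- (b :+ d)) ≡.refl
        (seq x n) (seq y n) (seq u n) (seq v n)))
    (p (0<* 0<½ 0<ε)) (q (0<* 0<½ 0<ε))

  -ᵣ-cong : ∀ x y → x ≈ᵣ y → -ᵣ x ≈ᵣ -ᵣ y
  -ᵣ-cong x y p {ε} 0<ε = ∀∞-map
    (λ n → subst (ℚ._< ε) (≡.trans (≡.sym (ℚ.∣-p∣≡∣p∣ (seq x n ℚ.- seq y n)))
      (cong ℚ.∣_∣ (solve 2 (λ a b → :- (a :- b) := :- a :- :- b) ≡.refl (seq x n) (seq y n)))))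
    (p 0<ε)

  -- From |xu - yv| ≤ |x||u - v| + |x - y||v| with eventual bounds a on |x| and b on |v|;
  -- `tolerance` picks δ with aδ + δb < ε.
  *ᵣ-cong : ∀ x y u v → x ≈ᵣ y → u ≈ᵣ v → x *ᵣ u ≈ᵣ y *ᵣ v
  *ᵣ-cong x y u v p q 0<ε =
    let a , 0<a , x≤a = bounded {seq x} (cauchy x)
        b , 0<b , v≤b = bounded {seq v} (cauchy v)
        δ , 0<δ , small = tolerance 0<a 0<b 0<ε
    in ∀∞-map₂
      (λ n (xn≤a , vn≤b) (dp , dq) → ℚ.≤-<-trans
        (∣ac-bd∣ (seq x n) (seq y n) (seq u n) (seq v n))
        (ℚ.≤-<-trans
          (ℚ.+-mono-≤
            (*-mono (ℚ.0≤∣p∣ (seq x n)) (ℚ.<⇒≤ 0<δ) xn≤a (ℚ.<⇒≤ dq))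
            (*-mono (ℚ.0≤∣p∣ (seq x n ℚ.- seq y n)) (ℚ.<⇒≤ 0<b) (ℚ.<⇒≤ dp) vn≤b))
          small))
      (∀∞-map₂ (λ _ → _,_) x≤a v≤b)
      (∀∞-map₂ (λ _ → _,_) (p 0<δ) (q 0<δ))

  -- The ring laws hold exactly at every index of the representing sequences, so each reduces to
  -- polynomial identities over ℚ.
  ≡⇒≈ : ∀ z w → (∀ n → seq (re z) n ≡ seq (re w) n) → (∀ n → seq (im z) n ≡ seq (im w) n) →
    z ≈ w
  ≡⇒≈ z w p q =
    ≡⇒≈ᵣ (re z) (re w) (0 , λ n _ → p n) , ≡⇒≈ᵣ (im z) (im w) (0 , λ n _ → q n)

  ≈-refl : ∀ z → z ≈ z
  ≈-refl z = ≡⇒≈ z z (λ _ → ≡.refl) (λ _ → ≡.refl)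

  ≈-sym : ∀ z w → z ≈ w → w ≈ z
  ≈-sym z w (p , q) = ≈ᵣ-sym (re z) (re w) p , ≈ᵣ-sym (im z) (im w) q

  ≈-trans : ∀ u v w → u ≈ v → v ≈ w → u ≈ w
  ≈-trans u v w (p , q) (p′ , q′) =
    ≈ᵣ-trans (re u) (re v) (re w) p p′ , ≈ᵣ-trans (im u) (im v) (im w) q q′

  +-cong : ∀ u v w z → u ≈ v → w ≈ z → u + w ≈ v + z
  +-cong u v w z (p , q) (p′ , q′) =
    +ᵣ-cong (re u) (re v) (re w) (re z) p p′ , +ᵣ-cong (im u) (im v) (im w) (im z) q q′

  neg-cong : ∀ z w → z ≈ w → - z ≈ - w
  neg-cong z w (p , q) = -ᵣ-cong (re z) (re w) p , -ᵣ-cong (im z) (im w) q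

  *-cong : ∀ u v w z → u ≈ v → w ≈ z → u * w ≈ v * z
  *-cong u v w z (p , q) (p′ , q′) =
    +ᵣ-cong (re u *ᵣ re w) (re v *ᵣ re z) (-ᵣ (im u *ᵣ im w)) (-ᵣ (im v *ᵣ im z))
      (*ᵣ-cong (re u) (re v) (re w) (re z) p p′)
      (-ᵣ-cong (im u *ᵣ im w) (im v *ᵣ im z) (*ᵣ-cong (im u) (im v) (im w) (im z) q q′)) ,
    +ᵣ-cong (re u *ᵣ im w) (re v *ᵣ im z) (im u *ᵣ re w) (im v *ᵣ re z)
      (*ᵣ-cong (re u) (re v) (im w) (im z) p q′)
      (*ᵣ-cong (im u) (im v) (re w) (re z) q p′)

  *-comm : ∀ z w → z * w ≈ w * z
  *-comm z w = ≡⇒≈ (z * w) (w * z)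
    (λ n → solve 4 (λ a b c d → a :* c :+ :- (b :* d) := c :* a :+ :- (d :* b)) ≡.refl
      (seq (re z) n) (seq (im z) n) (seq (re w) n) (seq (im w) n))
    (λ n → solve 4 (λ a b c d → a :* d :+ b :* c := c :* b :+ d :* a) ≡.refl
      (seq (re z) n) (seq (im z) n) (seq (re w) n) (seq (im w) n))

  *-assoc : ∀ u v w → u * v * w ≈ u * (v * w)
  *-assoc u v w = ≡⇒≈ (u * v * w) (u * (v * w))
    (λ n → solve 6 (λ a b c d e f →
      (a :* c :+ :- (b :* d)) :* e :+ :- ((a :* d :+ b :* c) :* f) :=
      a :* (c :* e :+ :- (d :* f)) :+ :- (b :* (c :* f :+ d :* e))) ≡.refl
      (seq (re u) n) (seq (im u) n) (seq (re v) n) (seq (im v) n) (seq (re w) n) (seq (im w) n))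
    (λ n → solve 6 (λ a b c d e f →
      (a :* c :+ :- (b :* d)) :* f :+ (a :* d :+ b :* c) :* e :=
      a :* (c :* f :+ d :* e) :+ b :* (c :* e :+ :- (d :* f))) ≡.refl
      (seq (re u) n) (seq (im u) n) (seq (re v) n) (seq (im v) n) (seq (re w) n) (seq (im w) n))

  *-identityˡ : ∀ z → 1# * z ≈ z
  *-identityˡ z = ≡⇒≈ (1# * z) z
    (λ n → solve 2 (λ a b → con 1ℚ :* a :+ :- (con 0ℚ :* b) := a) ≡.refl
      (seq (re z) n) (seq (im z) n))
    (λ n → solve 2 (λ a b → con 1ℚ :* b :+ con 0ℚ :* a := b) ≡.refl
      (seq (re z) n) (seq (im z) n))

  *-distribˡ-+ : ∀ u v w → u * (v + w) ≈ u * v + u * w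
  *-distribˡ-+ u v w = ≡⇒≈ (u * (v + w)) (u * v + u * w)
    (λ n → solve 6 (λ a b c d e f →
      a :* (c :+ e) :+ :- (b :* (d :+ f)) :=
      a :* c :+ :- (b :* d) :+ (a :* e :+ :- (b :* f))) ≡.refl
      (seq (re u) n) (seq (im u) n) (seq (re v) n) (seq (im v) n) (seq (re w) n) (seq (im w) n))
    (λ n → solve 6 (λ a b c d e f →
      a :* (d :+ f) :+ b :* (c :+ e) :=
      a :* d :+ b :* c :+ (a :* f :+ b :* e)) ≡.refl
      (seq (re u) n) (seq (im u) n) (seq (re v) n) (seq (im v) n) (seq (re w) n) (seq (im w) n))

  +-assoc : ∀ u v w → u + v + w ≈ u + (v + w)
  +-assoc u v w = ≡⇒≈ (u + v + w) (u + (v + w))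
    (λ n → ℚ.+-assoc (seq (re u) n) (seq (re v) n) (seq (re w) n))
    (λ n → ℚ.+-assoc (seq (im u) n) (seq (im v) n) (seq (im w) n))

  +-comm : ∀ z w → z + w ≈ w + z
  +-comm z w = ≡⇒≈ (z + w) (w + z)
    (λ n → ℚ.+-comm (seq (re z) n) (seq (re w) n))
    (λ n → ℚ.+-comm (seq (im z) n) (seq (im w) n))

  +-identityˡ : ∀ z → 0# + z ≈ z
  +-identityˡ z = ≡⇒≈ (0# + z) z
    (λ n → ℚ.+-identityˡ (seq (re z) n)) (λ n → ℚ.+-identityˡ (seq (im z) n))

  neg-inverseˡ : ∀ z → - z + z ≈ 0#
  neg-inverseˡ z = ≡⇒≈ (- z + z) 0#
    (λ n → ℚ.+-inverseˡ (seq (re z) n)) (λ n → ℚ.+-inverseˡ (seq (im z) n))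

  -- Termwise, z times the conjugate of w times w over |w|² is z once |w|² ≥ ε. At earlier indices
  -- `_⁻¹` may return its default 0, so the equality is only eventual.
  /-* : ∀ z w (w≉0 : w ≉0) → z / w ⟨ w≉0 ⟩ * w ≈ z
  /-* z w w≉0@(ε , 0<ε , p) =
    ≡⇒≈ᵣ (re (z / w ⟨ w≉0 ⟩ * w)) (re z) (∀∞-map
      (λ n ε≤∣w∣² →
        let a = seq (re z) n
            b = seq (im z) n
            c = seq (re w) n
            d = seq (im w) n
        in ≡.trans
          (solve 5 (λ a b c d r →
            (a :* (c :* r) :+ :- (b :* (:- d :* r))) :* c
              :+ :- ((a :* (:- d :* r) :+ b :* (c :* r)) :* d)
            := a :* ((c :* c :+ d :* d) :* r)) ≡.refl a b c d (norm c d ⁻¹))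
          (cancel a c d ε≤∣w∣²))
      p) ,
    ≡⇒≈ᵣ (im (z / w ⟨ w≉0 ⟩ * w)) (im z) (∀∞-map
      (λ n ε≤∣w∣² →
        let a = seq (re z) n
            b = seq (im z) n
            c = seq (re w) n
            d = seq (im w) n
        in ≡.trans
          (solve 5 (λ a b c d r →
            (a :* (c :* r) :+ :- (b :* (:- d :* r))) :* d
              :+ (a :* (:- d :* r) :+ b :* (c :* r)) :* c
            := b :* ((c :* c :+ d :* d) :* r)) ≡.refl a b c d (norm c d ⁻¹))
          (cancel b c d ε≤∣w∣²))
      p)
    where
    cancel : ∀ a c d → 0ℚ ℚ.+ ε ℚ.≤ norm c d → a ℚ.* (norm c d ℚ.* norm c d ⁻¹) ≡ a
    cancel a c d ε≤ = ≡.trans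
      (cong (a ℚ.*_) (*-⁻¹ (ℚ.<-≤-trans 0<ε
        (subst (ℚ._≤ norm c d) (ℚ.+-identityˡ ε) ε≤))))
      (ℚ.*-identityʳ a)

ℂ-isCommutativeRing : IsCommutativeRing _≈_ _+_ _*_ -_ 0# 1#
ℂ-isCommutativeRing = record
  { isRing = record
    { +-isAbelianGroup = record
      { isGroup = record
        { isMonoid = record
          { isSemigroup = record
            { isMagma = record
              { isEquivalence = record
                { refl  = λ {z} → ≈-refl z
                ; sym   = λ {z} {w} → ≈-sym z w
                ; trans = λ {u} {v} {w} → ≈-trans u v w
                }
              ; ∙-cong = λ {u} {v} {w} {z} → +-cong u v w z
              }
            ; assoc = +-assoc
            }
          ; identity = +-identityˡ , λ z → ≈-trans (z + 0#) (0# + z) z (+-comm z 0#) (+-identityˡ z)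
          }
        ; inverse = neg-inverseˡ ,
            λ z → ≈-trans (z + - z) (- z + z) 0# (+-comm z (- z)) (neg-inverseˡ z)
        ; ⁻¹-cong = λ {z} {w} → neg-cong z w
        }
      ; comm = +-comm
      }
    ; *-cong = λ {u} {v} {w} {z} → *-cong u v w z
    ; *-assoc = *-assoc
    ; *-identity = *-identityˡ , λ z → ≈-trans (z * 1#) (1# * z) z (*-comm z 1#) (*-identityˡ z)
    ; distrib = *-distribˡ-+ , λ u v w →
        ≈-trans ((v + w) * u) (u * (v + w)) (v * u + w * u) (*-comm (v + w) u)
          (≈-trans (u * (v + w)) (u * v + u * w) (v * u + w * u) (*-distribˡ-+ u v w)
            (+-cong (u * v) (v * u) (u * w) (w * u) (*-comm u v) (*-comm u w)))
    }
  ; *-comm = *-comm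
  }

ℂ-commutativeRing : CommutativeRing 0ℓ 0ℓ
ℂ-commutativeRing = record { isCommutativeRing = ℂ-isCommutativeRing }

-- In definitions, but not in type signatures, Agda replaces the _^_ of Defs by the
-- library function that it copies. Signatures are written with the latter: if the two
-- meet inside an equation, comparing them unfolds the arithmetic of ℚ.
open RawSemiringDefinitions using () renaming (_^_ to pow)

-- Specialisation to complex q with |q| < 1.

ℂ-functional-equation : FunctionalEquation _≈_ _+_ _*_ -_ 1#
  (pow (RawRing.rawSemiring ℂ-rawRing)) (λ {n} → sum {n})
ℂ-functional-equation = QSeries.functional-equation ℂ-commutativeRing

minus-def : ∀ z w → z - w ≈ z + - w
minus-def z w = ≡⇒≈ (z - w) (z + - w) (λ _ → ≡.refl) (λ _ → ≡.refl)

product-last : ∀ (f : ℕ → ℂ) n →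
  product (λ (i : Fin (suc n)) → f (toℕ i)) ≈ product (λ (i : Fin n) → f (toℕ i)) * f n
product-last = sum-last (CommutativeRing.*-monoid ℂ-commutativeRing)

pochhammer-suc : ∀ x p n →
  ⟨ x ⨾ p ⟩ suc n ≈ ⟨ x ⨾ p ⟩ n * (1# - x * pow (RawRing.rawSemiring ℂ-rawRing) p n)
pochhammer-suc x p = product-last (λ k → 1# - x * p ^ k)

module _ (q : ℂ) (∣q∣<1 : ∣ q ∣ <ᵣ 1ᵣ) where

  qBinomial-* : ∀ n k → qBinomial q ∣q∣<1 n k * (⟨ q ⨾ q ⟩ (n ℕ.∸ k) * ⟨ q ⨾ q ⟩ k) ≈ ⟨ q ⨾ q ⟩ n
  qBinomial-* n k =
    /-* (⟨ q ⨾ q ⟩ n) (⟨ q ⨾ q ⟩ (n ℕ.∸ k) * ⟨ q ⨾ q ⟩ k)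
      (*-≉0 (⟨ q ⨾ q ⟩ (n ℕ.∸ k)) (⟨ q ⨾ q ⟩ k)
        (⟨q⨾q⟩≉0 q ∣q∣<1 (n ℕ.∸ k)) (⟨q⨾q⟩≉0 q ∣q∣<1 k))

  -- The truncated subtraction in `qBinomial` is harmless here: (m + k) ∸ k is m.
  qBinomial-+ : ∀ m k →
    qBinomial q ∣q∣<1 (m ℕ.+ k) k * (⟨ q ⨾ q ⟩ m * ⟨ q ⨾ q ⟩ k) ≈ ⟨ q ⨾ q ⟩ (m ℕ.+ k)
  qBinomial-+ m k = subst
    (λ j → qBinomial q ∣q∣<1 (m ℕ.+ k) k * (⟨ q ⨾ q ⟩ j * ⟨ q ⨾ q ⟩ k) ≈ ⟨ q ⨾ q ⟩ (m ℕ.+ k))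
    (ℕ.m+n∸n≡m m k) (qBinomial-* (m ℕ.+ k) k)

  -- The powers are variables tied to `pow` by equations, so that `pow` and `_^_` are compared one
  -- power at a time, in `pow≡^`, and never inside the full equation.
  U-functional : ∀ m x {q² u v} →
    pow (RawRing.rawSemiring ℂ-rawRing) q 2 ≡ q² →
    pow (RawRing.rawSemiring ℂ-rawRing) q (suc m) ≡ u →
    pow (RawRing.rawSemiring ℂ-rawRing) x (suc m) ≡ v →
    U q ∣q∣<1 m (x * q²)
      ≈ (1# - x) * U q ∣q∣<1 m x
        + x * u * U q ∣q∣<1 m (x * q)
        + v * (⟨ q ⨾ q² ⟩ suc m / ⟨ q ⨾ q ⟩ m ⟨ ⟨q⨾q⟩≉0 q ∣q∣<1 m ⟩)
  U-functional m x ≡.refl ≡.refl ≡.refl =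
    FunctionalEquation.equation ℂ-functional-equation
      -- Each quotient below is supplied with `/-*` as its defining property; |q| < 1 makes the
      -- denominators (q;q)_n and (-q;q)_n apart from 0.
      _-_ minus-def ⟨_⨾_⟩_ (λ _ _ → ≈-refl 1#) pochhammer-suc q
      (λ n → 1# / ⟨ q ⨾ q ⟩ n ⟨ ⟨q⨾q⟩≉0 q ∣q∣<1 n ⟩)
      (λ n → 1# / ⟨ - q ⨾ q ⟩ n ⟨ ⟨-q⨾q⟩≉0 q ∣q∣<1 n ⟩)
      (λ n → /-* 1# (⟨ q ⨾ q ⟩ n) (⟨q⨾q⟩≉0 q ∣q∣<1 n))
      (λ n → /-* 1# (⟨ - q ⨾ q ⟩ n) (⟨-q⨾q⟩≉0 q ∣q∣<1 n))
      m (λ k → qBinomial q ∣q∣<1 (m ℕ.+ k) k) (qBinomial-+ m)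
      (λ k z → z ^ k / ⟨ - q ⨾ q ⟩ k ⟨ ⟨-q⨾q⟩≉0 q ∣q∣<1 k ⟩)
      (λ k z → /-* (z ^ k) (⟨ - q ⨾ q ⟩ k) (⟨-q⨾q⟩≉0 q ∣q∣<1 k))
      (U q ∣q∣<1 m) (λ _ → ≡.refl)
      x (⟨ q ⨾ q ^ 2 ⟩ suc m / ⟨ q ⨾ q ⟩ m ⟨ ⟨q⨾q⟩≉0 q ∣q∣<1 m ⟩)
      (/-* (⟨ q ⨾ q ^ 2 ⟩ suc m) (⟨ q ⨾ q ⟩ m) (⟨q⨾q⟩≉0 q ∣q∣<1 m))

pow≡^ : ∀ z k → pow (RawRing.rawSemiring ℂ-rawRing) z k ≡ z ^ k
pow≡^ z k = ≡.refl

theorem3p3 : ∀ (q : ℂ) (∣q∣<1 : ∣ q ∣ <ᵣ 1ᵣ) (m : ℕ) (x : ℂ) →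
    U q ∣q∣<1 m (x * q ^ 2)
    ≈ (1# - x) * U q ∣q∣<1 m x
    + x * q ^ suc m * U q ∣q∣<1 m (x * q)
    + x ^ suc m * (⟨ q ⨾ q ^ 2 ⟩ suc m / ⟨ q ⨾ q ⟩ m ⟨ ⟨q⨾q⟩≉0 q ∣q∣<1 m ⟩)
theorem3p3 q ∣q∣<1 m x =
  U-functional q ∣q∣<1 m x (pow≡^ q 2) (pow≡^ q (suc m)) (pow≡^ x (suc m))
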